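{- Let $n$ be a positive integer such that $\sqrt{n+1}$ is an integer. Then there is a red--blue coloring of the edges of $K_n$ such that every collection of monochromatic cycles, all of the same color, that together cover all vertices of $K_n$ contains at least $\lceil\sqrt n\,\rceil$ cycles. Specifically, this holds for the coloring obtained by partitioning $V(K_n)=A\cup B$ with $|A|=n-\lfloor\sqrt n\rfloor$ and $|B|=\lfloor\sqrt n\rfloor$, and coloring all edges inside $A$ blue and all remaining edges red.
   Context: A single vertex and a single edge (with its two endpoints) are regarded as (degenerate) cycles. A single vertex counts as a monochromatic cycle of either color; a single edge counts as a monochromatic cycle of its own color. A non-degenerate cycle (on at least $3$ vertices) is monochromatic of a given color if all its edges have that color. The cycles in a cover are allowed to intersect. -}

module Defs where

open import Data.Bool using (_∧_; if_then_else_)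
open import Data.Bool.Properties using (∧-comm)
open import Data.Fin using (Fin)
open import Data.Fin.Subset using (Subset; _∪_; _∩_; ⊤; ⊥)
open import Data.List using (List; []; _∷_; _++_; length; zip)
open import Data.List.Membership.Propositional using (_∈_)
open import Data.List.Relation.Unary.All using (All)
open import Data.List.Relation.Unary.Any using (Any)
open import Data.List.Relation.Unary.Unique.Propositional using (Unique)
open import Data.Nat using (ℕ; zero; suc; _*_; _≤_; _<_; _≤?_; z≤n; s≤s)
open import Data.Nat.Properties using (≤-trans; ≰⇒>; *-mono-≤; *-mono-<; n≤1+n; n<1+n)
open import Data.Product using (_×_; _,_; ∃-syntax)
open import Data.Vec using (lookup)
open import Relation.Binary.PropositionalEquality using (_≡_; _≢_; cong)
open import Relation.Nullary using (yes; no)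

⌊√_⌋ : ℕ → ℕ
⌊√ zero ⌋ = zero
⌊√ suc n ⌋ with suc ⌊√ n ⌋ * suc ⌊√ n ⌋ ≤? suc n
... | yes _ = suc ⌊√ n ⌋
... | no  _ = ⌊√ n ⌋

⌈√_⌉ : ℕ → ℕ
⌈√ zero ⌉ = zero
⌈√ suc n ⌉ with suc n ≤? ⌈√ n ⌉ * ⌈√ n ⌉
... | yes _ = ⌈√ n ⌉
... | no  _ = suc ⌈√ n ⌉

m²<[1+m]² : ∀ m → m * m < suc m * suc m
m²<[1+m]² m = *-mono-< (n<1+n m) (n<1+n m)

⌊√⌋-lower : ∀ n → ⌊√ n ⌋ * ⌊√ n ⌋ ≤ n
⌊√⌋-lower zero = z≤n
⌊√⌋-lower (suc n) with suc ⌊√ n ⌋ * suc ⌊√ n ⌋ ≤? suc n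
... | yes p = p
... | no  _ = ≤-trans (⌊√⌋-lower n) (n≤1+n n)

⌊√⌋-upper : ∀ n → n < suc ⌊√ n ⌋ * suc ⌊√ n ⌋
⌊√⌋-upper zero = s≤s z≤n
⌊√⌋-upper (suc n) with suc ⌊√ n ⌋ * suc ⌊√ n ⌋ ≤? suc n
... | yes _ = ≤-trans (s≤s (⌊√⌋-upper n)) (m²<[1+m]² (suc ⌊√ n ⌋))
... | no ¬p = ≰⇒> ¬p

⌈√⌉-upper : ∀ n → n ≤ ⌈√ n ⌉ * ⌈√ n ⌉
⌈√⌉-upper zero = z≤n
⌈√⌉-upper (suc n) with suc n ≤? ⌈√ n ⌉ * ⌈√ n ⌉
... | yes p = p
... | no  _ = ≤-trans (s≤s (⌈√⌉-upper n)) (m²<[1+m]² ⌈√ n ⌉)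

⌈√⌉-least : ∀ n s → n ≤ s * s → ⌈√ n ⌉ ≤ s
⌈√⌉-least zero s _ = z≤n
⌈√⌉-least (suc n) s q with suc n ≤? ⌈√ n ⌉ * ⌈√ n ⌉
... | yes _ = ⌈√⌉-least n s (≤-trans (n≤1+n n) q)
... | no ¬p = ≰⇒> λ s≤c → ¬p (≤-trans q (*-mono-≤ s≤c s≤c))

data Color : Set where
  red blue : Color

-- Colorings of the edges of the complete graph on Fin n.  The values on the
-- diagonal carry no meaning: no edge of a cycle below is a loop.
record Coloring (n : ℕ) : Set where
  field
    color : Fin n → Fin n → Color
    color-sym : ∀ u v → color u v ≡ color v u

open Coloring public

-- Cycles in the complete graph on Fin n, including the degenerate ones.
-- `cycle v vs` visits v, then the vertices of vs in order, and returns to v.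
data Cycle (n : ℕ) : Set where
  vertex : Fin n → Cycle n
  edge   : (u v : Fin n) → u ≢ v → Cycle n
  cycle  : (v : Fin n) (vs : List (Fin n)) →
           3 ≤ length (v ∷ vs) → Unique (v ∷ vs) → Cycle n

module _ {n : ℕ} where

  vertices : Cycle n → List (Fin n)
  vertices (vertex v)       = v ∷ []
  vertices (edge u v _)     = u ∷ v ∷ []
  vertices (cycle v vs _ _) = v ∷ vs

  edges : Cycle n → List (Fin n × Fin n)
  edges (vertex _)       = []
  edges (edge u v _)     = (u , v) ∷ []
  edges (cycle v vs _ _) = zip (v ∷ vs) (vs ++ v ∷ [])

  -- A single vertex is vacuously monochromatic of either color.
  Monochromatic : Coloring n → Color → Cycle n → Set
  Monochromatic χ c C = All (λ (u , v) → color χ u v ≡ c) (edges C)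

  Covers : List (Cycle n) → Set
  Covers Cs = ∀ v → Any (λ C → v ∈ vertices C) Cs

  -- Collections are lists, so repetitions are allowed and counted; a lower
  -- bound on their length bounds in particular the size of every finite set
  -- of cycles.
  EveryCover≥ : Coloring n → ℕ → Set
  EveryCover≥ χ k = ∀ (c : Color) (Cs : List (Cycle n)) →
    All (Monochromatic χ c) Cs → Covers Cs → k ≤ length Cs

  Partition : Subset n → Subset n → Set
  Partition A B = A ∪ B ≡ ⊤ × A ∩ B ≡ ⊥

  blueInside : Subset n → Coloring n
  blueInside A .color u v = if lookup A u ∧ lookup A v then blue else red
  blueInside A .color-sym u v =
    cong (λ b → if b then blue else red) (∧-comm (lookup A u) (lookup A v))

IsSquare : ℕ → Set
IsSquare n = ∃[ m ] m * m ≡ n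

{-# OPTIONS --safe #-}

-- Write k = ⌊√n⌋, so that n + 1 = (k + 1)², ∣B∣ = k and ∣A∣ = k (k + 1).
-- Red: in a red cycle the successor of a vertex of A lies in B, so the cycle
-- meets A in at most k vertices, and covering A takes at least k + 1 cycles.
-- Blue: a blue cycle that meets B is a single vertex, so covering B takes at
-- least k cycles, none of which meets the nonempty set A.
module Submission where

open import Defs
open import Data.Nat using (ℕ; suc; _+_; _*_; _∸_; _≤_; _<_; _>_; z≤n; s≤s; >-nonZero)
open import Data.Nat.Properties
open import Data.Fin using (Fin; zero; suc)
open import Data.Fin.Subset using (Subset; ∣_∣; inside; outside; _∈_; _∉_; _-_; ∁; ⊥; Nonempty)
open import Data.Fin.Subset.Properties
open import Data.List using (List; []; _∷_; _++_; length; zip; filter; concatMap)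
import Data.List.Membership.Propositional as List
open import Data.List.Membership.Propositional.Properties using (∈-concatMap⁺; ∈-filter⁺)
open import Data.List.Properties using (filter-++; length-++; length-filter; filter-none)
open import Data.List.Relation.Binary.Permutation.Propositional.Properties using (↭-length; filter-↭; ∷↭∷ʳ)
open import Data.List.Relation.Unary.All as All using (All; []; _∷_)
open import Data.List.Relation.Unary.All.Properties using (all-filter)
open import Data.List.Relation.Unary.Any using (Any; here; there)
open import Data.List.Relation.Unary.AllPairs using ([]; _∷_)
open import Data.List.Relation.Unary.Unique.Propositional using (Unique)
open import Data.List.Relation.Unary.Unique.Propositional.Properties using (filter⁺)
open import Data.Product using (_×_; _,_; proj₁; proj₂; ∃-syntax)
open import Data.Sum using (_⊎_; inj₁; inj₂)
open import Data.Vec using ([]; _∷_; here; there; lookup)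
open import Data.Vec.Properties using ([]=⇒lookup; lookup⇒[]=)
open import Function using (_∘_)
open import Relation.Binary.PropositionalEquality using (_≡_; refl; sym; trans; cong; subst)
open import Relation.Nullary using (yes; no; contradiction)
open import Relation.Unary using (Pred; Decidable)

All-zip⇒Allˡ : ∀ {a p} {X : Set a} {P : Pred X p} {xs ys : List X} →
  length xs ≤ length ys → All (P ∘ proj₁) (zip xs ys) → All P xs
All-zip⇒Allˡ {xs = []}                   _        _          = []
All-zip⇒Allˡ {xs = x ∷ xs} {ys = y ∷ ys} (s≤s le) (px ∷ pxs) = px ∷ All-zip⇒Allˡ le pxs

-- Meant for a cycle `xs` and its rotation `ys`, where aligned entries are a vertex and its
-- successor. The length bound ensures that `zip` drops no entry of `xs`.
filter-zip-mono : ∀ {a p q} {X : Set a} {P : Pred X p} {Q : Pred X q}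
  (P? : Decidable P) (Q? : Decidable Q) {xs ys : List X} → length xs ≤ length ys →
  All (λ (x , y) → P x → Q y) (zip xs ys) →
  length (filter P? xs) ≤ length (filter Q? ys)
filter-zip-mono P? Q? {[]}              _        _          = z≤n
filter-zip-mono P? Q? {x ∷ xs} {y ∷ ys} (s≤s le) (pq ∷ pqs)
  with P? x | Q? y | filter-zip-mono P? Q? {xs} {ys} le pqs
... | yes _  | yes _  | ih = s≤s ih
... | yes px | no ¬qy | _  = contradiction (pq px) ¬qy
... | no _   | yes _  | ih = m≤n⇒m≤1+n ih
... | no _   | no _   | ih = ih

∣p∣≤1+∣p-x∣ : ∀ {n} (p : Subset n) x → ∣ p ∣ ≤ suc ∣ p - x ∣
-- Removing `zero` subtracts the empty set from the tail, which reduces to `p` only propositionally.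
∣p∣≤1+∣p-x∣ (inside  ∷ p) zero    = s≤s (≤-reflexive (cong ∣_∣ (sym (p─⊥≡p p))))
∣p∣≤1+∣p-x∣ (outside ∷ p) zero    = m≤n⇒m≤1+n (≤-reflexive (cong ∣_∣ (sym (p─⊥≡p p))))
∣p∣≤1+∣p-x∣ (inside  ∷ p) (suc x) = s≤s (∣p∣≤1+∣p-x∣ p x)
∣p∣≤1+∣p-x∣ (outside ∷ p) (suc x) = ∣p∣≤1+∣p-x∣ p x

x∉p-x : ∀ {n} (p : Subset n) x → x ∉ p - x
x∉p-x (_ ∷ p) (suc x) (there x∈p-x) = x∉p-x p x x∈p-x

∃-of-size : ∀ {n k} → k ≤ n → ∃[ p ] ∣_∣ {n} p ≡ k
∃-of-size {n} z≤n = ⊥ , ∣⊥∣≡0 n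
∃-of-size (s≤s k≤n) = let p , ∣p∣≡k = ∃-of-size k≤n in inside ∷ p , cong suc ∣p∣≡k

module _ {n : ℕ} where

  -- Each list entry, repeated or not, accounts for at most one element of `p`: delete the head from
  -- `p` and recurse on the tail.
  ∣p∣≤length : ∀ {p : Subset n} xs → (∀ {x} → x ∈ p → x List.∈ xs) → ∣ p ∣ ≤ length xs
  ∣p∣≤length {p} [] p⊆[] = ≤-trans (p⊆q⇒∣p∣≤∣q∣ p⊆⊥) (≤-reflexive (∣⊥∣≡0 n))
    where
    p⊆⊥ : ∀ {x} → x ∈ p → x ∈ ⊥
    p⊆⊥ x∈p with () ← p⊆[] x∈p
  ∣p∣≤length {p} (x ∷ xs) p⊆x∷xs = ≤-trans (∣p∣≤1+∣p-x∣ p x) (s≤s (∣p∣≤length xs p-x⊆xs))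
    where
    p-x⊆xs : ∀ {y} → y ∈ p - x → y List.∈ xs
    p-x⊆xs y∈p-x with p⊆x∷xs (p─q⊆p p _ y∈p-x)
    ... | here refl  = contradiction y∈p-x (x∉p-x p x)
    ... | there y∈xs = y∈xs

  -- By distinctness the tail lies in `p - x`, which is strictly smaller than `p`.
  length≤∣p∣ : ∀ {p : Subset n} {xs} → Unique xs → All (_∈ p) xs → length xs ≤ ∣ p ∣
  length≤∣p∣ [] [] = z≤n
  length≤∣p∣ (x≢xs ∷ xs!) (x∈p ∷ xs⊆p) =
    ≤-trans (s≤s (length≤∣p∣ xs! (All.zipWith (λ (x≢y , y∈p) → x∈p∧x≢y⇒x∈p-y y∈p (x≢y ∘ sym)) (x≢xs , xs⊆p))))
            (x∈p⇒∣p-x∣<∣p∣ x∈p)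

  count : Subset n → List (Fin n) → ℕ
  count p xs = length (filter (_∈? p) xs)

  count-++ : ∀ p xs ys → count p (xs ++ ys) ≡ count p xs + count p ys
  count-++ p xs ys = trans (cong length (filter-++ (_∈? p) xs ys)) (length-++ (filter (_∈? p) xs))

  count-none : ∀ {p xs} → All (_∉ p) xs → count p xs ≡ 0
  count-none {p} = cong length ∘ filter-none (_∈? p)

  count-unique : ∀ {xs} p → Unique xs → count p xs ≤ ∣ p ∣
  count-unique {xs} p xs! = length≤∣p∣ (filter⁺ (_∈? p) xs!) (all-filter (_∈? p) xs)

  count-covers : ∀ {p} {Cs : List (Cycle n)} → Covers Cs → ∣ p ∣ ≤ count p (concatMap vertices Cs)
  count-covers cov = ∣p∣≤length _ (λ {x} → ∈-filter⁺ (_∈? _) (∈-concatMap⁺ vertices (cov x)))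

  count-concatMap-≤ : ∀ {p k} {Cs : List (Cycle n)} →
    All (λ C → count p (vertices C) ≤ k) Cs → count p (concatMap vertices Cs) ≤ length Cs * k
  count-concatMap-≤ [] = z≤n
  count-concatMap-≤ {p} {Cs = C ∷ Cs} (c≤k ∷ cs≤k) =
    ≤-trans (≤-reflexive (count-++ p (vertices C) _)) (+-mono-≤ c≤k (count-concatMap-≤ cs≤k))

  -- The cycle that misses `p` contributes nothing but is still counted in the length; this supplies
  -- the extra cycle in the blue case.
  count-concatMap-< : ∀ {p} {Cs : List (Cycle n)} →
    All (λ C → count p (vertices C) ≤ 1) Cs → Any (λ C → count p (vertices C) ≡ 0) Cs →
    count p (concatMap vertices Cs) < length Cs
  count-concatMap-< {p} {C ∷ Cs} (_ ∷ cs≤1) (here c≡0) =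
    s≤s (≤-trans (≤-reflexive (trans (count-++ p (vertices C) _) (cong (_+ _) c≡0)))
                 (≤-trans (count-concatMap-≤ cs≤1) (≤-reflexive (*-identityʳ _))))
  count-concatMap-< {p} {C ∷ Cs} (c≤1 ∷ cs≤1) (there any) =
    s≤s (≤-trans (≤-reflexive (count-++ p (vertices C) _))
                 (≤-trans (+-monoˡ-≤ _ c≤1) (count-concatMap-< cs≤1 any)))

  ∣p∣>0⇒Nonempty : ∀ (p : Subset n) → ∣ p ∣ > 0 → Nonempty p
  ∣p∣>0⇒Nonempty p ∣p∣>0 with nonempty? p
  ... | yes p≢∅ = p≢∅
  ... | no  p≡∅ = contradiction (trans (cong ∣_∣ (Empty-unique p≡∅)) (∣⊥∣≡0 n)) (>⇒≢ ∣p∣>0)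

  module _ (A : Subset n) where

    blue⇒∈ : ∀ u v → color (blueInside A) u v ≡ blue → u ∈ A × v ∈ A
    blue⇒∈ u v eq with lookup A u in equ | lookup A v in eqv
    ... | inside | inside = lookup⇒[]= u A equ , lookup⇒[]= v A eqv

    red⇒∉ : ∀ u v → color (blueInside A) u v ≡ red → u ∈ A → v ∉ A
    red⇒∉ u v eq u∈A v∈A rewrite []=⇒lookup u∈A | []=⇒lookup v∈A with () ← eq

    -- Blue edges have both ends in `A`, and every vertex of a cycle other than a single vertex lies
    -- on one of its edges.
    blue-cycle : ∀ C → Monochromatic (blueInside A) blue C →
      (∃[ v ] C ≡ vertex v) ⊎ All (_∈ A) (vertices C)
    blue-cycle (vertex v) _ = inj₁ (v , refl)
    blue-cycle (edge u v _) (uv ∷ []) = let u∈A , v∈A = blue⇒∈ u v uv in inj₂ (u∈A ∷ v∈A ∷ [])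
    blue-cycle (cycle v vs _ _) mono =
      -- Each vertex is the first component of the edge to its successor, so left endpoints suffice.
      inj₂ (All-zip⇒Allˡ (≤-reflexive (↭-length (∷↭∷ʳ v vs))) (All.map (λ {(x , y)} → proj₁ ∘ blue⇒∈ x y) mono))

    module _ {B : Subset n} (part : Partition A B) where

      ∉⇒∈ : ∀ {x} → x ∉ A → x ∈ B
      ∉⇒∈ {x} x∉A with x∈p∪q⁻ A B (subst (x ∈_) (sym (proj₁ part)) ∈⊤)
      ... | inj₁ x∈A = contradiction x∈A x∉A
      ... | inj₂ x∈B = x∈B

      ∈⇒∉ : ∀ {x} → x ∈ A → x ∉ B
      ∈⇒∉ {x} x∈A x∈B = ∉⊥ (subst (x ∈_) (proj₂ part) (x∈p∩q⁺ (x∈A , x∈B)))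

      -- On a proper cycle the successor map injects the vertices in `A` into those in `B`. A
      -- degenerate cycle has at most one vertex in `A`, whence the need for a nonempty `B`.
      red-count : ∣ B ∣ > 0 → ∀ C → Monochromatic (blueInside A) red C → count A (vertices C) ≤ ∣ B ∣
      red-count B>0 (vertex v) _ = ≤-trans (length-filter (_∈? A) (v ∷ [])) B>0
      red-count B>0 (edge u v _) (uv ∷ []) with u ∈? A
      ... | yes u∈A = ≤-trans (s≤s (≤-reflexive (count-none (red⇒∉ u v uv u∈A ∷ [])))) B>0
      ... | no _    = ≤-trans (length-filter (_∈? A) (v ∷ [])) B>0
      red-count _ (cycle v vs _ unique) mono = begin
        count A (v ∷ vs)       ≤⟨ filter-zip-mono (_∈? A) (_∈? B) (≤-reflexive (↭-length rotate))
                                    (All.map (λ {(x , y)} xy → ∉⇒∈ ∘ red⇒∉ x y xy) mono) ⟩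
        -- The list of successors is a rotation of the cycle, so undoing it preserves the count and
        -- makes `unique` applicable.
        count B (vs ++ v ∷ []) ≡⟨ ↭-length (filter-↭ (_∈? B) rotate) ⟨
        count B (v ∷ vs)       ≤⟨ count-unique B unique ⟩
        ∣ B ∣                  ∎
        where
        open ≤-Reasoning
        rotate = ∷↭∷ʳ v vs

      blue-count : ∀ C → Monochromatic (blueInside A) blue C → count B (vertices C) ≤ 1
      blue-count C mono with blue-cycle C mono
      ... | inj₁ (v , refl) = length-filter (_∈? B) (v ∷ [])
      ... | inj₂ C⊆A = ≤-trans (≤-reflexive (count-none (All.map ∈⇒∉ C⊆A))) z≤n

      blue-count-0 : ∀ {a} → a ∈ A → ∀ C → Monochromatic (blueInside A) blue C →
        a List.∈ vertices C → count B (vertices C) ≡ 0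
      blue-count-0 a∈A C mono a∈C with blue-cycle C mono | a∈C
      ... | inj₁ (v , refl) | here refl = count-none (∈⇒∉ a∈A ∷ [])
      ... | inj₂ C⊆A        | _         = count-none (All.map ∈⇒∉ C⊆A)

      blueInside-cover : ∀ {k} → k > 0 → ∣ A ∣ ≡ suc k * k → ∣ B ∣ ≡ k → EveryCover≥ (blueInside A) (suc k)
      blueInside-cover {k} k>0 ∣A∣≡ refl red Cs mono cov =
        -- Each red cycle covers at most `k` of the `suc k * k` vertices of `A`; cancel the positive
        -- factor `k`.
        *-cancelʳ-≤ (suc k) (length Cs) k ⦃ >-nonZero k>0 ⦄ (begin
          suc k * k                        ≡⟨ ∣A∣≡ ⟨
          ∣ A ∣                            ≤⟨ count-covers cov ⟩
          count A (concatMap vertices Cs)  ≤⟨ count-concatMap-≤ (All.map (λ {C} → red-count k>0 C) mono) ⟩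
          length Cs * k                    ∎)
        where open ≤-Reasoning
      blueInside-cover {k} k>0 ∣A∣≡ refl blue Cs mono cov =
        -- Some cycle `C` must cover a vertex `a` of `A`, and being blue it avoids `B`.
        let a , a∈A        = ∣p∣>0⇒Nonempty A (≤-trans k>0 (≤-trans (m≤n*m k (suc k)) (≤-reflexive (sym ∣A∣≡))))
            C , C∈Cs , a∈C = List.find (cov a)
        in ≤-trans (s≤s (count-covers cov))
             (count-concatMap-< (All.map (λ {C} → blue-count C) mono)
               (List.lose C∈Cs (blue-count-0 a∈A C (All.lookup mono C∈Cs) a∈C)))

-- If `m * m` is `n + 1`, it exceeds the square of `⌊√ n ⌋`, so `m` is at least `suc ⌊√ n ⌋`; the
-- reverse inequality is the upper bound defining the floor.
suc⌊√⌋²≡1+n : ∀ n → IsSquare (n + 1) → suc ⌊√ n ⌋ * suc ⌊√ n ⌋ ≡ suc n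
suc⌊√⌋²≡1+n n (m , m²≡n+1) = ≤-antisym
  (≤-trans (*-mono-≤ k<m k<m) (≤-reflexive m²≡1+n)) (⌊√⌋-upper n)
  where
  m²≡1+n : m * m ≡ suc n
  m²≡1+n = trans m²≡n+1 (+-comm n 1)
  k<m : ⌊√ n ⌋ < m
  k<m = ≰⇒> λ m≤k → <⇒≱ (≤-reflexive (sym m²≡1+n)) (≤-trans (*-mono-≤ m≤k m≤k) (⌊√⌋-lower n))

mainTheorem2 : ∀ (n : ℕ) → n > 0 → IsSquare (n + 1) →
    (∃[ χ ] EveryCover≥ {n} χ ⌈√ n ⌉)
    × (∀ (A B : Subset n) → Partition A B →
    ∣ A ∣ ≡ n ∸ ⌊√ n ⌋ → ∣ B ∣ ≡ ⌊√ n ⌋ →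
    EveryCover≥ (blueInside A) ⌈√ n ⌉)
mainTheorem2 n n>0 sq = exists , bound
  where
  k = ⌊√ n ⌋

  n≡k+[1+k]k : n ≡ k + suc k * k
  -- `suc k * suc k` computes to `suc (k + k * suc k)`, so one `suc` cancels.
  n≡k+[1+k]k = trans (suc-injective (sym (suc⌊√⌋²≡1+n n sq))) (cong (k +_) (*-comm k (suc k)))

  n∸k≡[1+k]k : n ∸ k ≡ suc k * k
  n∸k≡[1+k]k = trans (cong (_∸ k) n≡k+[1+k]k) (m+n∸m≡n k (suc k * k))

  k>0 : k > 0
  -- With `k` zero, the formula for `n` would evaluate to zero.
  k>0 = n≢0⇒n>0 λ k≡0 → <⇒≢ n>0 (sym (trans n≡k+[1+k]k (cong (λ j → j + suc j * j) k≡0)))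

  ⌈√n⌉≤1+k : ⌈√ n ⌉ ≤ suc k
  ⌈√n⌉≤1+k = ⌈√⌉-least n (suc k) (<⇒≤ (⌊√⌋-upper n))

  bound : ∀ (A B : Subset n) → Partition A B → ∣ A ∣ ≡ n ∸ k → ∣ B ∣ ≡ k →
    EveryCover≥ (blueInside A) ⌈√ n ⌉
  bound A B part ∣A∣≡ ∣B∣≡ c Cs mono cov =
    ≤-trans ⌈√n⌉≤1+k (blueInside-cover A part k>0 (trans ∣A∣≡ n∸k≡[1+k]k) ∣B∣≡ c Cs mono cov)

  exists : ∃[ χ ] EveryCover≥ {n} χ ⌈√ n ⌉
  exists =
    -- Any `B` of size `k` will do, with its complement as `A`.
    let B , ∣B∣≡k = ∃-of-size {n} {k} (≤-trans (m≤m+n k (suc k * k)) (≤-reflexive (sym n≡k+[1+k]k)))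
    in blueInside (∁ B) , bound (∁ B) B (∪-inverseˡ B , ∩-inverseˡ B)
         (trans (∣∁p∣≡n∸∣p∣ B) (cong (n ∸_) ∣B∣≡k)) ∣B∣≡k
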